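{- If $e$ is an inner edge of the root graph of a construction $G$, then there are two constructions $H_W$ and $H_E$ such that $G$ is $\rho$-equivalent to $H_W[e_W-e_E]H_E$ (where, by the notational convention for cuts, $e$ is the new edge introduced by the cut $[e_W-e_E]$).
   Context: **Digraphs.** A digraph is an irreflexive binary relation $D$ on a finite nonempty set, the set of vertices of $D$. The ordered pairs in $D$ are its edges; an edge $(a,b)$ begins in $a$ and ends in $b$. An oriented graph is an antisymmetric digraph. A W-vertex of $D$ is a vertex in which no edge ends; an E-vertex is a vertex in which no edge begins; an inner vertex is one that is neither. A W-edge is an edge beginning in a W-vertex; an E-edge is an edge ending in an E-vertex; an inner edge is an edge beginning in an inner vertex and ending in an inner vertex. A W-edge $(a,b)$ is functional when $(a,c)\in D$ implies $c=b$; an E-edge $(b,a)$ is functional when $(c,a)\in D$ implies $c=b$. Digraphs are disjoint when their vertex sets are disjoint. **Basic K-graphs.** A basic K-graph $B$ is an oriented graph with vertices $a_1,\dots,a_{k_W},b,c_1,\dots,c_{k_E}$ (all distinct, $k_W,k_E\ge 1$) and edges exactly $(a_i,b)$ for $1\le i\le k_W$ and $(b,c_j)$ for $1\le j\le k_E$, together with distinguished W-edges $NW(B),SW(B)$ and distinguished E-edges $NE(B),SE(B)$, such that for each $X\in\{W,E\}$: if $k_X\ge 2$, then $NX(B)\ne SX(B)$. **Cut.** Let $D_W,D_E$ be disjoint oriented graphs, $e_W=(a,b)$ a functional E-edge of $D_W$ and $e_E=(c,d)$ a functional W-edge of $D_E$. With $e=(a,d)$, $D_W[e_W-e_E]D_E$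 is the oriented graph $(D_W-\{e_W\})\cup(D_E-\{e_E\})\cup\{e\}$ on the union of the vertices of $D_W$ and $D_E$ with $b$ and $c$ omitted. The edge $e$ is the new edge introduced by the cut; similarly $f$ for $[f_W-f_E]$. **Constructions.** A construction $G$ is a finite binary tree with an oriented graph and distinguished edges at each node; the graph at the root is the root graph of $G$, and its distinguished edges at the root are denoted $YX(G)$, $Y\in\{N,S\}$, $X\in\{W,E\}$. Constructions are defined inductively: (1) a single-node tree whose node carries a basic K-graph $B$ with its distinguished edges is a construction; (2) if $G_W,G_E$ are constructions with disjoint root graphs $D_W,D_E$, $e_W$ is a functional E-edge of $D_W$ and $e_E$ is a functional W-edge of $D_E$, and for every $Y\in\{N,S\}$ we have $e_W=YE(G_W)$ or $e_E=YW(G_E)$, then $G=G_W[e_W-e_E]G_E$ is a construction: its tree has a new root whose successors are the roots of $G_W$ and $G_E$, its root graph is $D_W[e_W-e_E]D_E$, and for $Y\in\{N,S\}$, $YW(G)=YW(G_W)$ if $e_E=YW(G_E)$ and $YW(G)=YW(G_E)$ otherwise; $YE(G)=YE(G_E)$ if $e_W=YE(G_W)$ and $YE(G)=YE(G_W)$ otherwise. The other nodes keep their data from $G_W$ and $G_E$. **$\rho$-equivalence.** Let $P,Q,R$ be constructions. Define relations between constructions $G_1$ and $G_2$ as follows. - $\rho_1$: $G_1=(P[e_W-e_E]Q)[f_W-f_E]R$ and $G_2=P[e_W-e_E](Q[f_W-f_E]R)$, where $e_W,f_W$ are E-edges of the root graphs of $P,Q$ and $e_E,f_E$ are W-edges of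 the root graphs of $Q,R$ respectively. - $\rho_2$: $G_1=(P[e_W-e_E]Q)[f_W-f_E]R$ and $G_2=(P[f_W-f_E]R)[e_W-e_E]Q$, where $e_W,f_W$ are different E-edges of the root graph of $P$ and $e_E,f_E$ are W-edges of the root graphs of $Q,R$ respectively. - $\rho_3$: $G_1=R[f_W-f_E](Q[e_W-e_E]P)$ and $G_2=Q[e_W-e_E](R[f_W-f_E]P)$, where $e_E,f_E$ are different W-edges of the root graph of $P$ and $e_W,f_W$ are E-edges of the root graphs of $Q,R$ respectively. $\rho$-equivalence is the equivalence relation between constructions that is the reflexive, symmetric and transitive closure of $\rho_1\cup\rho_2\cup\rho_3$, and which is closed moreover under $\rho$-congruence: if $G_1$ is $\rho$-equivalent with $G_2$ and $H_1$ is $\rho$-equivalent with $H_2$, then $G_1[e_W-e_E]H_1$ is $\rho$-equivalent with $G_2[e_W-e_E]H_2$, provided the last two constructions are defined.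
   Formalization: The formal statement assumes that the basic K-graphs at the leaves of G have pairwise disjoint vertex sets; if a vertex omitted in a cut may be reused elsewhere in G, the claim as written fails, because a re-associated cut need not be defined. -}

module Defs where

open import Data.Empty using (⊥-elim)
open import Data.List.Base using (List; []; _∷_; _++_; [_]; filter; length)
open import Data.List.Membership.Propositional using (_∈_; _∉_)
open import Data.List.Membership.Propositional.Properties
  using (∈-++⁺ˡ; ∈-++⁺ʳ; ∈-filter⁺)
open import Data.List.Relation.Binary.Disjoint.Propositional using (Disjoint)
open import Data.List.Relation.Unary.All as All using ()
open import Data.List.Relation.Unary.AllPairs using (AllPairs; []; _∷_)
open import Data.List.Relation.Unary.Any using (here; there)
open import Data.List.Relation.Unary.Unique.Propositional using (Unique)
open import Data.Nat.Base using (ℕ; _≤_)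
open import Data.Product.Base using (_×_; _,_; proj₁; proj₂; uncurry)
open import Data.Product.Properties using (≡-dec)
open import Data.Sum.Base using (_⊎_; inj₁; inj₂)
open import Function.Base using (_∘_; _on_)
open import Level using (0ℓ)
open import Relation.Binary.Core using (Rel)
open import Relation.Binary.Definitions
  using (DecidableEquality; Irreflexive; Antisymmetric)
open import Relation.Binary.PropositionalEquality
  using (_≡_; _≢_; refl; sym; trans; cong; subst)
open import Relation.Nullary.Decidable using (¬?; yes; no)
open import Relation.Nullary.Negation using (¬_)

data Side : Set where
  W E : Side

data Pole : Set where
  N S : Pole

module Constructions {V : Set} (_≟_ : DecidableEquality V) where

  Edge : Set
  Edge = V × V

  _≟ᵉ_ : DecidableEquality Edge
  _≟ᵉ_ = ≡-dec _≟_ _≟_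

  ----------------------------------------------------------------------
  -- Digraphs

  -- The finite vertex set is given by an enumeration; order and repetitions
  -- in the list carry no meaning.
  record Digraph : Set₁ where
    field
      vertices : List V
      nonempty : vertices ≢ []
      _⟶_      : Rel V 0ℓ
      source∈  : ∀ {x y} → x ⟶ y → x ∈ vertices
      target∈  : ∀ {x y} → x ⟶ y → y ∈ vertices
      irrefl   : Irreflexive _≡_ _⟶_

    IsEdge : Edge → Set
    IsEdge = uncurry _⟶_

    WVertex EVertex InnerVertex : V → Set
    WVertex v = v ∈ vertices × (∀ u → ¬ (u ⟶ v))
    EVertex v = v ∈ vertices × (∀ u → ¬ (v ⟶ u))
    InnerVertex v = v ∈ vertices × ¬ WVertex v × ¬ EVertex v

    WEdge EEdge InnerEdge : Edge → Set
    WEdge e = IsEdge e × WVertex (proj₁ e)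
    EEdge e = IsEdge e × EVertex (proj₂ e)
    InnerEdge e = IsEdge e × InnerVertex (proj₁ e) × InnerVertex (proj₂ e)

    SideEdge : Side → Edge → Set
    SideEdge W = WEdge
    SideEdge E = EEdge

    FunctionalWEdge FunctionalEEdge : Edge → Set
    FunctionalWEdge (a , b) = WEdge (a , b) × (∀ {c} → a ⟶ c → c ≡ b)
    FunctionalEEdge (b , a) = EEdge (b , a) × (∀ {c} → c ⟶ a → c ≡ b)

  record OrientedGraph : Set₁ where
    field
      digraph : Digraph
    open Digraph digraph public
    field
      antisym : Antisymmetric _≡_ _⟶_

  open OrientedGraph using
    ( vertices; InnerEdge; WEdge; EEdge; SideEdge
    ; FunctionalWEdge; FunctionalEEdge )

  ----------------------------------------------------------------------
  -- Basic K-graphs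

  private
    Unique-++⇒Disjoint : ∀ (xs : List V) {ys} → Unique (xs ++ ys) → Disjoint xs ys
    Unique-++⇒Disjoint (x ∷ xs) (x∉ ∷ _) (here refl , v∈ys) =
      All.lookup x∉ (∈-++⁺ʳ xs v∈ys) refl
    Unique-++⇒Disjoint (x ∷ xs) (_ ∷ u) (there v∈xs , v∈ys) =
      Unique-++⇒Disjoint xs u (v∈xs , v∈ys)

    Unique-++⁻ʳ : ∀ (xs : List V) {ys} → Unique (xs ++ ys) → Unique ys
    Unique-++⁻ʳ []       u       = u
    Unique-++⁻ʳ (x ∷ xs) (_ ∷ u) = Unique-++⁻ʳ xs u

    ++∷≢[] : ∀ (xs : List V) {y ys} → xs ++ y ∷ ys ≢ []
    ++∷≢[] []       ()
    ++∷≢[] (x ∷ xs) ()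

  -- as enumerates the aᵢ and cs the cⱼ, so length as is k_W and length cs is k_E.
  record Star : Set where
    field
      as       : List V
      b        : V
      cs       : List V
      1≤kW     : 1 ≤ length as
      1≤kE     : 1 ≤ length cs
      distinct : Unique (as ++ b ∷ cs)

    k : Side → ℕ
    k W = length as
    k E = length cs

    private
      as#bcs : Disjoint as (b ∷ cs)
      as#bcs = Unique-++⇒Disjoint as distinct

      b∉as : b ∉ as
      b∉as b∈as = as#bcs (b∈as , here refl)

      b∉cs : b ∉ cs
      b∉cs b∈cs =
        Unique-++⇒Disjoint [ b ] (Unique-++⁻ʳ as distinct) (here refl , b∈cs)

    graph : OrientedGraph
    graph = record
      { digraph = record
        { vertices = as ++ b ∷ cs
        ; nonempty = ++∷≢[] as
        ; _⟶_      = λ x y → (x ∈ as × y ≡ b) ⊎ (x ≡ b × y ∈ cs)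
        ; source∈  = λ { (inj₁ (x∈as , _)) → ∈-++⁺ˡ x∈as
                       ; (inj₂ (x≡b , _)) → ∈-++⁺ʳ as (here x≡b) }
        ; target∈  = λ { (inj₁ (_ , y≡b)) → ∈-++⁺ʳ as (here y≡b)
                       ; (inj₂ (_ , y∈cs)) → ∈-++⁺ʳ as (there y∈cs) }
        ; irrefl   = λ { refl (inj₁ (b∈as , refl)) → b∉as b∈as
                       ; refl (inj₂ (refl , b∈cs)) → b∉cs b∈cs }
        }
      ; antisym = λ { (inj₁ (b∈as , refl)) (inj₁ (_ , refl)) → refl
                    ; (inj₁ (x∈as , _)) (inj₂ (_ , x∈cs)) →
                        ⊥-elim (as#bcs (x∈as , there x∈cs))
                    ; (inj₂ (_ , y∈cs)) (inj₁ (y∈as , _)) →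
                        ⊥-elim (as#bcs (y∈as , there y∈cs))
                    ; (inj₂ (refl , _)) (inj₂ (refl , _)) → refl }
      }

  record BasicKGraph : Set where
    field
      star : Star
    open Star star public
    field
      distinguished      : Pole → Side → Edge
      distinguished-edge : ∀ Y X → SideEdge graph X (distinguished Y X)
      N≢S                : ∀ X → 2 ≤ k X → distinguished N X ≢ distinguished S X

  ----------------------------------------------------------------------
  -- Cut

  newEdge : Edge → Edge → Edge
  newEdge (a , b) (c , d) = a , d

  module _ (Dᵂ : OrientedGraph) (eᵂ eᴱ : Edge) (Dᴱ : OrientedGraph)
           (disjoint : Disjoint (vertices Dᵂ) (vertices Dᴱ))
           (funW : FunctionalEEdge Dᵂ eᵂ) (funE : FunctionalWEdge Dᴱ eᴱ)
           where

    private
      module DW = OrientedGraph Dᵂ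
      module DE = OrientedGraph Dᴱ

      a b c d : V
      a = proj₁ eᵂ
      b = proj₂ eᵂ
      c = proj₁ eᴱ
      d = proj₂ eᴱ

      vs : List V
      vs = filter (λ v → ¬? (v ≟ b)) DW.vertices ++ filter (λ v → ¬? (v ≟ c)) DE.vertices

      _↝_ : Rel V 0ℓ
      x ↝ y = (x DW.⟶ y × (x , y) ≢ eᵂ)
            ⊎ (x DE.⟶ y × (x , y) ≢ eᴱ)
            ⊎ (x , y) ≡ newEdge eᵂ eᴱ

      ab : a DW.⟶ b
      ab = proj₁ (proj₁ funW)

      cd : c DE.⟶ d
      cd = proj₁ (proj₁ funE)

      ∈W : ∀ {v} → v ∈ DW.vertices → v ≢ b → v ∈ vs
      ∈W v∈ v≢b = ∈-++⁺ˡ (∈-filter⁺ (λ v → ¬? (v ≟ b)) v∈ v≢b)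

      ∈E : ∀ {v} → v ∈ DE.vertices → v ≢ c → v ∈ vs
      ∈E v∈ v≢c = ∈-++⁺ʳ _ (∈-filter⁺ (λ v → ¬? (v ≟ c)) v∈ v≢c)

      a∈ : a ∈ vs
      a∈ = ∈W (DW.source∈ ab) (λ a≡b → DW.irrefl a≡b ab)

      d∈ : d ∈ vs
      d∈ = ∈E (DE.target∈ cd) (λ d≡c → DE.irrefl (sym d≡c) cd)

      source : ∀ {x y} → x ↝ y → x ∈ vs
      source (inj₁ (xy , _)) =
        ∈W (DW.source∈ xy) λ { refl → proj₂ (proj₂ (proj₁ funW)) _ xy }
      source (inj₂ (inj₁ (xy , xy≢cd))) =
        ∈E (DE.source∈ xy) λ { refl → xy≢cd (cong (c ,_) (proj₂ funE xy)) }
      source (inj₂ (inj₂ refl)) = a∈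

      target : ∀ {x y} → x ↝ y → y ∈ vs
      target (inj₁ (xy , xy≢ab)) =
        ∈W (DW.target∈ xy) λ { refl → xy≢ab (cong (_, b) (proj₂ funW xy)) }
      target (inj₂ (inj₁ (xy , _))) =
        ∈E (DE.target∈ xy) λ { refl → proj₂ (proj₂ (proj₁ funE)) _ xy }
      target (inj₂ (inj₂ refl)) = d∈

      a∉E : a ∉ DE.vertices
      a∉E a∈E = disjoint (DW.source∈ ab , a∈E)

      d∉W : d ∉ DW.vertices
      d∉W d∈W = disjoint (d∈W , DE.target∈ cd)

      anti : Antisymmetric _≡_ _↝_
      anti (inj₁ (p , _)) (inj₁ (q , _)) = DW.antisym p q
      anti (inj₁ (p , _)) (inj₂ (inj₁ (q , _))) =
        ⊥-elim (disjoint (DW.source∈ p , DE.target∈ q))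
      anti (inj₁ (p , _)) (inj₂ (inj₂ refl)) = ⊥-elim (d∉W (DW.source∈ p))
      anti (inj₂ (inj₁ (p , _))) (inj₁ (q , _)) =
        ⊥-elim (disjoint (DW.source∈ q , DE.target∈ p))
      anti (inj₂ (inj₁ (p , _))) (inj₂ (inj₁ (q , _))) = DE.antisym p q
      anti (inj₂ (inj₁ (p , _))) (inj₂ (inj₂ refl)) = ⊥-elim (a∉E (DE.target∈ p))
      anti (inj₂ (inj₂ refl)) (inj₁ (q , _)) = ⊥-elim (d∉W (DW.source∈ q))
      anti (inj₂ (inj₂ refl)) (inj₂ (inj₁ (q , _))) = ⊥-elim (a∉E (DE.target∈ q))
      anti (inj₂ (inj₂ refl)) (inj₂ (inj₂ q)) = sym (cong proj₁ q)

      irr : Irreflexive _≡_ _↝_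
      irr refl (inj₁ (p , _))        = DW.irrefl refl p
      irr refl (inj₂ (inj₁ (p , _))) = DE.irrefl refl p
      irr refl (inj₂ (inj₂ p))       =
        a∉E (subst (_∈ DE.vertices)
                   (trans (sym (cong proj₂ p)) (cong proj₁ p)) (DE.target∈ cd))

      nonempty-vs : vs ≢ []
      nonempty-vs vs≡[] with () ← subst (a ∈_) vs≡[] a∈

    cutGraph : OrientedGraph
    cutGraph = record
      { digraph = record
        { vertices = vs
        ; nonempty = nonempty-vs
        ; _⟶_      = _↝_
        ; source∈  = source
        ; target∈  = target
        ; irrefl   = irr
        }
      ; antisym = anti
      }

  ----------------------------------------------------------------------
  -- Constructions

  data Construction : Set
  record Cuttable (Gᵂ : Construction) (eᵂ eᴱ : Edge) (Gᴱ : Construction) : Set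

  root : Construction → OrientedGraph
  -- dist Y X G is the distinguished edge YX(G) of the root graph.
  dist : Pole → Side → Construction → Edge

  -- The graphs and distinguished edges of the nodes are determined by the
  -- leaves and the pairs of edges cut, so only the latter are stored;
  -- root and dist compute the former.
  data Construction where
    basic      : BasicKGraph → Construction
    _[_-_]_by_ : ∀ Gᵂ eᵂ eᴱ Gᴱ → Cuttable Gᵂ eᵂ eᴱ Gᴱ → Construction

  record Cuttable Gᵂ eᵂ eᴱ Gᴱ where
    inductive
    field
      disjoint      : Disjoint (vertices (root Gᵂ)) (vertices (root Gᴱ))
      functionalW   : FunctionalEEdge (root Gᵂ) eᵂ
      functionalE   : FunctionalWEdge (root Gᴱ) eᴱ
      distinguished : ∀ Y → eᵂ ≡ dist Y E Gᵂ ⊎ eᴱ ≡ dist Y W Gᴱ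

  root (basic B) = BasicKGraph.graph B
  root (Gᵂ [ eᵂ - eᴱ ] Gᴱ by p) =
    cutGraph (root Gᵂ) eᵂ eᴱ (root Gᴱ) disjoint functionalW functionalE
    where open Cuttable p

  dist Y X (basic B) = BasicKGraph.distinguished B Y X
  dist Y W (Gᵂ [ eᵂ - eᴱ ] Gᴱ by _) with eᴱ ≟ᵉ dist Y W Gᴱ
  ... | yes _ = dist Y W Gᵂ
  ... | no  _ = dist Y W Gᴱ
  dist Y E (Gᵂ [ eᵂ - eᴱ ] Gᴱ by _) with eᵂ ≟ᵉ dist Y E Gᵂ
  ... | yes _ = dist Y E Gᴱ
  ... | no  _ = dist Y E Gᵂ

  leaves : Construction → List BasicKGraph
  leaves (basic B)                = [ B ]
  leaves (Gᵂ [ _ - _ ] Gᴱ by _) = leaves Gᵂ ++ leaves Gᴱ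

  -- A vertex omitted in a cut is absent from the root graph of the result, so
  -- disjointness of root graphs alone does not prevent it from occurring again
  -- elsewhere in the tree.  In that case a cut may fail to be permutable with
  -- another: (P[eᵂ-eᴱ]Q)[fᵂ-fᴱ]R may be defined while P and Q[fᵂ-fᴱ]R
  -- share the vertex omitted by eᵂ.  LeavesDisjoint is the convention that
  -- omitted vertices are chosen apart from all others.
  LeavesDisjoint : Construction → Set
  LeavesDisjoint G = AllPairs (Disjoint on (vertices ∘ BasicKGraph.graph)) (leaves G)

  ----------------------------------------------------------------------
  -- ρ-equivalence

  -- The Cuttable arguments express that both sides are defined.  Since they are
  -- universally quantified in ρ₁–ρ₃ and ≈-cong, ≈ρ does not distinguish
  -- constructions that differ only in these proofs.

  infix 4 _ρ₁_ _ρ₂_ _ρ₃_ _≈ρ_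

  data _ρ₁_ : Rel Construction 0ℓ where
    ρ₁-step : ∀ {P Q R eᵂ eᴱ fᵂ fᴱ}
              (p : Cuttable P eᵂ eᴱ Q)
              (q : Cuttable (P [ eᵂ - eᴱ ] Q by p) fᵂ fᴱ R)
              (r : Cuttable Q fᵂ fᴱ R)
              (s : Cuttable P eᵂ eᴱ (Q [ fᵂ - fᴱ ] R by r)) →
              EEdge (root P) eᵂ → EEdge (root Q) fᵂ →
              WEdge (root Q) eᴱ → WEdge (root R) fᴱ →
              (P [ eᵂ - eᴱ ] Q by p) [ fᵂ - fᴱ ] R by q ρ₁
              P [ eᵂ - eᴱ ] (Q [ fᵂ - fᴱ ] R by r) by s

  data _ρ₂_ : Rel Construction 0ℓ where
    ρ₂-step : ∀ {P Q R eᵂ eᴱ fᵂ fᴱ}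
              (p : Cuttable P eᵂ eᴱ Q)
              (q : Cuttable (P [ eᵂ - eᴱ ] Q by p) fᵂ fᴱ R)
              (r : Cuttable P fᵂ fᴱ R)
              (s : Cuttable (P [ fᵂ - fᴱ ] R by r) eᵂ eᴱ Q) →
              eᵂ ≢ fᵂ → EEdge (root P) eᵂ → EEdge (root P) fᵂ →
              WEdge (root Q) eᴱ → WEdge (root R) fᴱ →
              (P [ eᵂ - eᴱ ] Q by p) [ fᵂ - fᴱ ] R by q ρ₂
              (P [ fᵂ - fᴱ ] R by r) [ eᵂ - eᴱ ] Q by s

  data _ρ₃_ : Rel Construction 0ℓ where
    ρ₃-step : ∀ {P Q R eᵂ eᴱ fᵂ fᴱ}
              (p : Cuttable Q eᵂ eᴱ P)
              (q : Cuttable R fᵂ fᴱ (Q [ eᵂ - eᴱ ] P by p))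
              (r : Cuttable R fᵂ fᴱ P)
              (s : Cuttable Q eᵂ eᴱ (R [ fᵂ - fᴱ ] P by r)) →
              eᴱ ≢ fᴱ → WEdge (root P) eᴱ → WEdge (root P) fᴱ →
              EEdge (root Q) eᵂ → EEdge (root R) fᵂ →
              R [ fᵂ - fᴱ ] (Q [ eᵂ - eᴱ ] P by p) by q ρ₃
              Q [ eᵂ - eᴱ ] (R [ fᵂ - fᴱ ] P by r) by s

  data _≈ρ_ : Rel Construction 0ℓ where
    ≈-ρ₁    : ∀ {G₁ G₂} → G₁ ρ₁ G₂ → G₁ ≈ρ G₂
    ≈-ρ₂    : ∀ {G₁ G₂} → G₁ ρ₂ G₂ → G₁ ≈ρ G₂
    ≈-ρ₃    : ∀ {G₁ G₂} → G₁ ρ₃ G₂ → G₁ ≈ρ G₂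
    ≈-refl  : ∀ {G} → G ≈ρ G
    ≈-sym   : ∀ {G₁ G₂} → G₁ ≈ρ G₂ → G₂ ≈ρ G₁
    ≈-trans : ∀ {G₁ G₂ G₃} → G₁ ≈ρ G₂ → G₂ ≈ρ G₃ → G₁ ≈ρ G₃
    ≈-cong  : ∀ {G₁ G₂ H₁ H₂ eᵂ eᴱ} → G₁ ≈ρ G₂ → H₁ ≈ρ H₂ →
              (p : Cuttable G₁ eᵂ eᴱ H₁) (q : Cuttable G₂ eᵂ eᴱ H₂) →
              G₁ [ eᵂ - eᴱ ] H₁ by p ≈ρ G₂ [ eᵂ - eᴱ ] H₂ by q

{-# OPTIONS --safe #-}

-- By induction on G.  If e is not introduced by the last cut [fᵂ-fᴱ] of G, it
-- is an inner edge of the root graph of one of the two parts, which is by the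
-- induction hypothesis ρ-equivalent to some P[eᵂ-eᴱ]Q with new edge e.  The
-- edge of that part cut by f is different from e, so it comes from P or from
-- Q, and the cut f can be moved inside: by ρ₁ if P, Q and the remaining part
-- are in a row, and by ρ₂ or ρ₃ if both cuts are on the same side of P or Q.
-- Since leaves are disjoint, a distinguished edge of one of the three parts is
-- never an edge cut off another one, which makes the permuted cuts defined.

module Submission where

open import Defs
open import Data.Empty using (⊥; ⊥-elim)
open import Data.List.Base using (List; []; _∷_; _++_)
open import Data.List.Membership.Propositional using (_∈_)
open import Data.List.Membership.Propositional.Properties using (∈-++⁻; ∈-filter⁻)
open import Data.List.Relation.Binary.Disjoint.Propositional using (Disjoint)
open import Data.List.Relation.Unary.All as All using (All)
open import Data.List.Relation.Unary.All.Properties as All using ()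
open import Data.List.Relation.Unary.AllPairs using (AllPairs; []; _∷_)
open import Data.List.Relation.Unary.Any as Any using (Any; here)
open import Data.List.Relation.Unary.Any.Properties as Any using ()
open import Data.Product.Base using (_×_; _,_; proj₁; proj₂; ∃-syntax)
open import Data.Sum.Base as Sum using (_⊎_; inj₁; inj₂; [_,_]′)
open import Function.Base using (_∘_; _∘′_; flip′)
open import Relation.Binary.Core using (Rel)
open import Relation.Binary.Definitions using (DecidableEquality)
open import Relation.Binary.PropositionalEquality
  using (_≡_; _≢_; refl; sym; trans; cong; subst)
open import Relation.Nullary.Decidable using (yes; no; ¬?)
open import Relation.Nullary.Negation using (¬_; contradiction)

AllPairs-++⁻ : ∀ {a ℓ} {A : Set a} {R : Rel A ℓ} (xs : List A) {ys} → AllPairs R (xs ++ ys) →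
               AllPairs R xs × AllPairs R ys × All (λ x → All (R x) ys) xs
AllPairs-++⁻ []       ps       = [] , ps , All.[]
AllPairs-++⁻ (x ∷ xs) (p ∷ ps) with pxs , pys , pxys ← AllPairs-++⁻ xs ps =
  All.++⁻ˡ xs p ∷ pxs , pys , All.++⁻ʳ xs p All.∷ pxys

module _ {V : Set} (_≟_ : DecidableEquality V) where

  open Constructions _≟_
  open OrientedGraph using
    ( vertices; source∈; target∈; WVertex; EVertex; InnerVertex
    ; InnerEdge; FunctionalWEdge; FunctionalEEdge )
  open Cuttable

  private variable
    G P Q R : Construction
    e f eᵂ eᴱ fᵂ fᴱ : Edge
    v x y : V

  infix 4 _∈ᴸ_ _#_ _∼_ _∋_

  _∋_ : Construction → Edge → Set
  G ∋ e = OrientedGraph.IsEdge (root G) e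

  -- Vertices and apartness

  -- Membership in the leaves also covers vertices omitted by cuts. These reappear in root graphs
  -- when cuts are permuted, so disjointness has to be tracked at this level.
  _∈ᴸ_ : V → Construction → Set
  v ∈ᴸ G = Any (λ B → v ∈ vertices (BasicKGraph.graph B)) (leaves G)

  _#_ : Rel Construction _
  P # Q = ∀ {v} → v ∈ᴸ P → v ∈ᴸ Q → ⊥

  module _ {p : Cuttable P eᵂ eᴱ Q} where

    private G₀ = P [ eᵂ - eᴱ ] Q by p

    ∈ᴸ-left : v ∈ᴸ P → v ∈ᴸ G₀
    ∈ᴸ-left = Any.++⁺ˡ

    ∈ᴸ-right : v ∈ᴸ Q → v ∈ᴸ G₀
    ∈ᴸ-right = Any.++⁺ʳ (leaves P)

    ∈ᴸ-cut⁻ : v ∈ᴸ G₀ → v ∈ᴸ P ⊎ v ∈ᴸ Q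
    ∈ᴸ-cut⁻ = Any.++⁻ (leaves P)

    #-cutʳ : R # P → R # Q → R # G₀
    #-cutʳ R#P R#Q v∈R v∈G = [ R#P v∈R , R#Q v∈R ]′ (∈ᴸ-cut⁻ v∈G)

    #-cutˡ : P # R → Q # R → G₀ # R
    #-cutˡ P#R Q#R v∈G v∈R = [ (λ v∈P → P#R v∈P v∈R) , (λ v∈Q → Q#R v∈Q v∈R) ]′ (∈ᴸ-cut⁻ v∈G)

    LeavesDisjoint-cut⁻ : LeavesDisjoint G₀ → LeavesDisjoint P × LeavesDisjoint Q × P # Q
    LeavesDisjoint-cut⁻ ld with ldP , ldQ , ldPQ ← AllPairs-++⁻ (leaves P) ld =
      ldP , ldQ , λ v∈P v∈Q →
        All.lookupWith
          (λ apart v∈B → All.lookupWith (λ disj v∈C → disj (v∈B , v∈C)) apart v∈Q) ldPQ v∈P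

  root⇒∈ᴸ : ∀ G → v ∈ vertices (root G) → v ∈ᴸ G
  root⇒∈ᴸ (basic B) v∈ = here v∈
  root⇒∈ᴸ (P [ _ - _ ] Q by p) v∈ with ∈-++⁻ _ v∈
  ... | inj₁ v∈P = ∈ᴸ-left {p = p} (root⇒∈ᴸ P (proj₁ (∈-filter⁻ (λ _ → ¬? (_ ≟ _)) v∈P)))
  ... | inj₂ v∈Q = ∈ᴸ-right {p = p} (root⇒∈ᴸ Q (proj₁ (∈-filter⁻ (λ _ → ¬? (_ ≟ _)) v∈Q)))

  source∈ᴸ : ∀ G → G ∋ e → proj₁ e ∈ᴸ G
  source∈ᴸ G e∈ = root⇒∈ᴸ G (source∈ (root G) e∈)

  target∈ᴸ : ∀ G → G ∋ e → proj₂ e ∈ᴸ G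
  target∈ᴸ G e∈ = root⇒∈ᴸ G (target∈ (root G) e∈)

  #⇒Disjoint : ∀ P Q → P # Q → Disjoint (vertices (root P)) (vertices (root Q))
  #⇒Disjoint P Q P#Q (v∈P , v∈Q) = P#Q (root⇒∈ᴸ P v∈P) (root⇒∈ᴸ Q v∈Q)

  source-≢ : ∀ P Q → P # Q → proj₁ e ∈ᴸ P → proj₁ f ∈ᴸ Q → e ≢ f
  source-≢ _ _ P#Q e∈P f∈Q refl = P#Q e∈P f∈Q

  target-≢ : ∀ P Q → P # Q → proj₂ e ∈ᴸ P → proj₂ f ∈ᴸ Q → e ≢ f
  target-≢ _ _ P#Q e∈P f∈Q refl = P#Q e∈P f∈Q

  #⇒≢ : ∀ P Q → P # Q → P ∋ e → Q ∋ f → e ≢ f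
  #⇒≢ P Q P#Q e∈P f∈Q = source-≢ P Q P#Q (source∈ᴸ P e∈P) (source∈ᴸ Q f∈Q)

  cutW∋ : Cuttable P eᵂ eᴱ Q → P ∋ eᵂ
  cutW∋ p = proj₁ (proj₁ (functionalW p))

  cutE∋ : Cuttable P eᵂ eᴱ Q → Q ∋ eᴱ
  cutE∋ p = proj₁ (proj₁ (functionalE p))

  -- Distinguished edges

  -- Here f is the edge that one part loses in a cut, u the distinguished edge
  -- of that part and v the corresponding one of the other part.
  replace : Edge → Edge → Edge → Edge
  replace f u v with f ≟ᵉ u
  ... | yes _ = v
  ... | no  _ = u

  replace-hit : ∀ {f u v} → f ≡ u → replace f u v ≡ v
  replace-hit {f} {u} f≡u with f ≟ᵉ u
  ... | yes _  = refl
  ... | no f≢u = contradiction f≡u f≢u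

  replace-miss : ∀ {f u v} → f ≢ u → replace f u v ≡ u
  replace-miss {f} {u} f≢u with f ≟ᵉ u
  ... | yes f≡u = contradiction f≡u f≢u
  ... | no _    = refl

  replace-elim : ∀ (A : Edge → Set) f {u v} → A u → A v → A (replace f u v)
  replace-elim A f {u} au av with f ≟ᵉ u
  ... | yes _ = av
  ... | no _  = au

  -- For three parts in a row: `f` is cut off the middle part, so it cannot hit the distinguished
  -- edge `p` of an outer one. If `e` misses `p`, both sides are therefore `p`.
  replace-assoc : ∀ {e f p q r} → f ≢ p →
                  replace f (replace e p q) r ≡ replace e p (replace f q r)
  replace-assoc {e} {p = p} f≢p with e ≟ᵉ p
  ... | yes _ = refl
  ... | no _  = replace-miss f≢p

  -- For two edges cut off the same part: at most one of them is its distinguished edge `p`, and the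
  -- edge that takes the place of `p` is not hit by the other cut.
  replace-swap-inner : ∀ {e f p q r} → e ≢ f → f ≢ q → e ≢ r →
                       replace f (replace e p q) r ≡ replace e (replace f p r) q
  replace-swap-inner {e} {f} {p} e≢f f≢q e≢r with e ≟ᵉ p | f ≟ᵉ p
  ... | yes refl | yes refl = contradiction refl e≢f
  ... | yes refl | no _     = trans (replace-miss f≢q) (sym (replace-hit refl))
  ... | no _     | yes refl = trans (replace-hit refl) (sym (replace-miss e≢r))
  ... | no e≢p   | no f≢p   = trans (replace-miss f≢p) (sym (replace-miss e≢p))

  -- For two parts attached to a common one, seen from the side of the attached parts. If both cuts
  -- missed, the sides would be `r` and `q`; the hypothesis excludes exactly this case.
  replace-swap-outer : ∀ {e f p q r} → f ≡ r ⊎ e ≡ q →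
                       replace f r (replace e q p) ≡ replace e q (replace f r p)
  replace-swap-outer {e} {f} {q = q} {r} one with e ≟ᵉ q | f ≟ᵉ r
  ... | yes _  | yes _  = refl
  ... | yes _  | no _   = refl
  ... | no _   | yes _  = refl
  ... | no e≢q | no f≢r = [ (λ eq → contradiction eq f≢r) , (λ eq → contradiction eq e≢q) ]′ one

  from-replacement : ∀ {e f p q} → f ≢ p → f ≡ replace e p q → f ≡ q
  from-replacement {e} {f} {q = q} f≢p =
    replace-elim (λ u → f ≡ u → f ≡ q) e (λ f≡p → contradiction f≡p f≢p) (λ f≡q → f≡q)

  from-original : ∀ {e f p q} → f ≢ q → f ≡ replace e p q → f ≡ p
  from-original {e} {f} {p} f≢q =
    replace-elim (λ u → f ≡ u → f ≡ p) e (λ f≡p → f≡p) (λ f≡q → contradiction f≡q f≢q)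

  -- The condition on distinguished edges for the outer cut after reassociation. If `e` is not `p`,
  -- the inner cut leaves `p` distinguished, so `f ≢ p` forces `f′ ≡ r′`, and then `q′` is the edge
  -- inherited.
  distinguished-assoc : ∀ {e e′ f f′ p q q′ r′} → f ≢ p →
                        e ≡ p ⊎ e′ ≡ q′ → f ≡ replace e p q ⊎ f′ ≡ r′ →
                        e ≡ p ⊎ e′ ≡ replace f′ r′ q′
  distinguished-assoc f≢p (inj₁ e≡p) _ = inj₁ e≡p
  distinguished-assoc f≢p (inj₂ e′≡q′) (inj₂ f′≡r′) = inj₂ (trans e′≡q′ (sym (replace-hit f′≡r′)))
  distinguished-assoc {e} {p = p} f≢p (inj₂ _) (inj₁ f≡) with e ≟ᵉ p
  ... | yes e≡p = inj₁ e≡p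
  ... | no _    = contradiction f≡ f≢p

  dist-W : ∀ Y (p : Cuttable P eᵂ eᴱ Q) →
           dist Y W (P [ eᵂ - eᴱ ] Q by p) ≡ replace eᴱ (dist Y W Q) (dist Y W P)
  dist-W {eᴱ = eᴱ} {Q} Y p with eᴱ ≟ᵉ dist Y W Q
  ... | yes _ = refl
  ... | no _  = refl

  dist-E : ∀ Y (p : Cuttable P eᵂ eᴱ Q) →
           dist Y E (P [ eᵂ - eᴱ ] Q by p) ≡ replace eᵂ (dist Y E P) (dist Y E Q)
  dist-E {P} {eᵂ} Y p with eᵂ ≟ᵉ dist Y E P
  ... | yes _ = refl
  ... | no _  = refl

  -- Locating the source in a leaf is enough to separate a distinguished edge from the edges of an
  -- apart construction; whether it is still an edge of the root graph need not be followed through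
  -- the cuts.
  dist-source : ∀ Y X G → proj₁ (dist Y X G) ∈ᴸ G
  dist-source Y W (basic B) =
    here (source∈ (BasicKGraph.graph B) (proj₁ (BasicKGraph.distinguished-edge B Y W)))
  dist-source Y E (basic B) =
    here (source∈ (BasicKGraph.graph B) (proj₁ (BasicKGraph.distinguished-edge B Y E)))
  dist-source Y W G@(P [ _ - eᴱ ] Q by p) rewrite dist-W Y p =
    replace-elim (λ e → proj₁ e ∈ᴸ G) eᴱ
      (∈ᴸ-right {p = p} (dist-source Y W Q)) (∈ᴸ-left {p = p} (dist-source Y W P))
  dist-source Y E G@(P [ eᵂ - _ ] Q by p) rewrite dist-E Y p =
    replace-elim (λ e → proj₁ e ∈ᴸ G) eᵂ
      (∈ᴸ-left {p = p} (dist-source Y E P)) (∈ᴸ-right {p = p} (dist-source Y E Q))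

  #⇒≢dist : ∀ Y X P Q → P # Q → P ∋ e → e ≢ dist Y X Q
  #⇒≢dist Y X P Q P#Q e∈P = source-≢ P Q P#Q (source∈ᴸ P e∈P) (dist-source Y X Q)

  -- Constructions that behave alike under cuts

  -- Replacing a part of a cut by an equivalent one through `≈-cong` requires the new cut to be
  -- defined, and this relation carries the data for that. Root graphs are compared by edges alone,
  -- since the vertices in question are ends of edges; leaves are compared by their vertices, since
  -- permuting cuts reorders them.
  record _∼_ (G H : Construction) : Set where
    field
      edge⁺ : ∀ {x y} → G ∋ (x , y) → H ∋ (x , y)
      edge⁻ : ∀ {x y} → H ∋ (x , y) → G ∋ (x , y)
      dist≡ : ∀ Y X → dist Y X G ≡ dist Y X H
      leaf⁺ : ∀ {v} → v ∈ᴸ G → v ∈ᴸ H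
      leaf⁻ : ∀ {v} → v ∈ᴸ H → v ∈ᴸ G

  open _∼_

  ∼-refl : G ∼ G
  ∼-refl = record
    { edge⁺ = λ e → e ; edge⁻ = λ e → e ; dist≡ = λ _ _ → refl
    ; leaf⁺ = λ v → v ; leaf⁻ = λ v → v }

  ∼-sym : ∀ {G H} → G ∼ H → H ∼ G
  ∼-sym s = record
    { edge⁺ = edge⁻ s ; edge⁻ = edge⁺ s ; dist≡ = λ Y X → sym (dist≡ s Y X)
    ; leaf⁺ = leaf⁻ s ; leaf⁻ = leaf⁺ s }

  ∼-trans : ∀ {G H K} → G ∼ H → H ∼ K → G ∼ K
  ∼-trans s t = record
    { edge⁺ = λ e → edge⁺ t (edge⁺ s e) ; edge⁻ = λ e → edge⁻ s (edge⁻ t e)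
    ; dist≡ = λ Y X → trans (dist≡ s Y X) (dist≡ t Y X)
    ; leaf⁺ = λ v → leaf⁺ t (leaf⁺ s v) ; leaf⁻ = λ v → leaf⁻ s (leaf⁻ t v) }

  functionalE-resp : ∀ {G H} → G ∼ H → FunctionalEEdge (root G) e → FunctionalEEdge (root H) e
  functionalE-resp {H = H} s ((e∈ , _ , no-out) , unique) =
    (edge⁺ s e∈ , target∈ (root H) (edge⁺ s e∈) , λ u out → no-out u (edge⁻ s out)) ,
    λ into → unique (edge⁻ s into)

  functionalW-resp : ∀ {G H} → G ∼ H → FunctionalWEdge (root G) e → FunctionalWEdge (root H) e
  functionalW-resp {H = H} s ((e∈ , _ , no-in) , unique) =
    (edge⁺ s e∈ , source∈ (root H) (edge⁺ s e∈) , λ u into → no-in u (edge⁻ s into)) ,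
    λ out → unique (edge⁻ s out)

  -- Disjointness is obtained from the leaves, because `_∼_` says nothing about vertex sets of root
  -- graphs.
  cuttable-resp : ∀ {P P′ Q Q′} → P ∼ P′ → Q ∼ Q′ → P # Q →
                  Cuttable P e f Q → Cuttable P′ e f Q′
  cuttable-resp {P′ = P′} {Q′ = Q′} s t P#Q p = record
    { disjoint      = #⇒Disjoint P′ Q′ λ v∈P′ v∈Q′ → P#Q (leaf⁻ s v∈P′) (leaf⁻ t v∈Q′)
    ; functionalW   = functionalE-resp s (functionalW p)
    ; functionalE   = functionalW-resp t (functionalE p)
    ; distinguished = λ Y → Sum.map (λ eq → trans eq (dist≡ s Y E)) (λ eq → trans eq (dist≡ t Y W))
                                    (distinguished p Y)
    }

  ∼-cut : ∀ {P P′ Q Q′} → P ∼ P′ → Q ∼ Q′ → (p : Cuttable P e f Q) (p′ : Cuttable P′ e f Q′) →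
          P [ e - f ] Q by p ∼ P′ [ e - f ] Q′ by p′
  ∼-cut {e} {f} {P} {P′} {Q} {Q′} s t p p′ = record
    { edge⁺ = Sum.map (λ (g , ne) → edge⁺ s g , ne) (Sum.map₁ λ (g , ne) → edge⁺ t g , ne)
    ; edge⁻ = Sum.map (λ (g , ne) → edge⁻ s g , ne) (Sum.map₁ λ (g , ne) → edge⁻ t g , ne)
    ; dist≡ = dists
    ; leaf⁺ = λ v∈ → [ (λ v∈P → ∈ᴸ-left {p = p′} (leaf⁺ s v∈P))
                     , (λ v∈Q → ∈ᴸ-right {p = p′} (leaf⁺ t v∈Q)) ]′ (∈ᴸ-cut⁻ {p = p} v∈)
    ; leaf⁻ = λ v∈ → [ (λ v∈P → ∈ᴸ-left {p = p} (leaf⁻ s v∈P))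
                     , (λ v∈Q → ∈ᴸ-right {p = p} (leaf⁻ t v∈Q)) ]′ (∈ᴸ-cut⁻ {p = p′} v∈)
    }
    where
    dists : ∀ Y X → dist Y X (P [ e - f ] Q by p) ≡ dist Y X (P′ [ e - f ] Q′ by p′)
    dists Y W rewrite dist-W Y p | dist-W Y p′ | dist≡ s Y W | dist≡ t Y W = refl
    dists Y E rewrite dist-E Y p | dist-E Y p′ | dist≡ s Y E | dist≡ t Y E = refl

  -- Functional edges before and after a cut

  module _ (p : Cuttable P eᵂ eᴱ Q) (P#Q : P # Q) where

    private G₀ = P [ eᵂ - eᴱ ] Q by p

    -- All edges of `P` but `eᵂ` survive the cut. If `eᵂ` began in the target of `f`, so would the
    -- new edge; if it ended there, its own functionality would make it equal to `f`.
    functionalE-left⁻ : f ≢ eᵂ → P ∋ f →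
                        FunctionalEEdge (root G₀) f → FunctionalEEdge (root P) f
    functionalE-left⁻ {f} f≢eᵂ f∈P ((_ , _ , no-out) , unique) =
      (f∈P , target∈ (root P) f∈P , no-out′) , unique′
      where
      no-out′ : ∀ u → ¬ P ∋ (proj₂ f , u)
      no-out′ u out with (proj₂ f , u) ≟ᵉ eᵂ
      ... | yes refl = no-out _ (inj₂ (inj₂ refl))
      ... | no ≢eᵂ   = no-out u (inj₁ (out , ≢eᵂ))

      unique′ : P ∋ (x , proj₂ f) → x ≡ proj₁ f
      unique′ {x} into with (x , proj₂ f) ≟ᵉ eᵂ
      ... | yes refl = contradiction (cong (_, proj₂ f) (proj₂ (functionalW p) f∈P)) f≢eᵂ
      ... | no ≢eᵂ   = unique (inj₁ (into , ≢eᵂ))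

    functionalE-right⁻ : Q ∋ f → FunctionalEEdge (root G₀) f → FunctionalEEdge (root Q) f
    functionalE-right⁻ {f} f∈Q ((_ , _ , no-out) , unique) =
      (f∈Q , target∈ (root Q) f∈Q , no-out′) , unique′
      where
      no-out′ : ∀ u → ¬ Q ∋ (proj₂ f , u)
      no-out′ u out with (proj₂ f , u) ≟ᵉ eᴱ
      ... | yes refl = proj₂ (proj₂ (proj₁ (functionalE p))) _ f∈Q
      ... | no ≢eᴱ   = no-out u (inj₂ (inj₁ (out , ≢eᴱ)))

      unique′ : Q ∋ (x , proj₂ f) → x ≡ proj₁ f
      unique′ {x} into with (x , proj₂ f) ≟ᵉ eᴱ
      -- If `eᴱ` ends in the target of `f`, so does the new edge, and uniqueness identifies the
      -- source of `eᵂ`, a vertex of `P`, with that of `f`.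
      ... | yes refl = ⊥-elim (P#Q (source∈ᴸ P (cutW∋ p))
                         (subst (_∈ᴸ Q) (sym (unique (inj₂ (inj₂ refl)))) (source∈ᴸ Q f∈Q)))
      ... | no ≢eᴱ   = unique (inj₂ (inj₁ (into , ≢eᴱ)))

    functionalW-right⁻ : f ≢ eᴱ → Q ∋ f →
                         FunctionalWEdge (root G₀) f → FunctionalWEdge (root Q) f
    functionalW-right⁻ {f} f≢eᴱ f∈Q ((_ , _ , no-in) , unique) =
      (f∈Q , source∈ (root Q) f∈Q , no-in′) , unique′
      where
      no-in′ : ∀ u → ¬ Q ∋ (u , proj₁ f)
      no-in′ u into with (u , proj₁ f) ≟ᵉ eᴱ
      ... | yes refl = no-in _ (inj₂ (inj₂ refl))
      ... | no ≢eᴱ   = no-in u (inj₂ (inj₁ (into , ≢eᴱ)))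

      unique′ : Q ∋ (proj₁ f , y) → y ≡ proj₂ f
      unique′ {y} out with (proj₁ f , y) ≟ᵉ eᴱ
      ... | yes refl = contradiction (cong (proj₁ f ,_) (proj₂ (functionalE p) f∈Q)) f≢eᴱ
      ... | no ≢eᴱ   = unique (inj₂ (inj₁ (out , ≢eᴱ)))

    functionalW-left⁻ : P ∋ f → FunctionalWEdge (root G₀) f → FunctionalWEdge (root P) f
    functionalW-left⁻ {f} f∈P ((_ , _ , no-in) , unique) =
      (f∈P , source∈ (root P) f∈P , no-in′) , unique′
      where
      no-in′ : ∀ u → ¬ P ∋ (u , proj₁ f)
      no-in′ u into with (u , proj₁ f) ≟ᵉ eᵂ
      ... | yes refl = proj₂ (proj₂ (proj₁ (functionalW p))) _ f∈P
      ... | no ≢eᵂ   = no-in u (inj₁ (into , ≢eᵂ))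

      unique′ : P ∋ (proj₁ f , y) → y ≡ proj₂ f
      unique′ {y} out with (proj₁ f , y) ≟ᵉ eᵂ
      ... | yes refl = ⊥-elim (P#Q
                         (subst (_∈ᴸ P) (sym (unique (inj₂ (inj₂ refl)))) (target∈ᴸ P f∈P))
                         (target∈ᴸ Q (cutE∋ p)))
      ... | no ≢eᵂ   = unique (inj₁ (out , ≢eᵂ))

    functionalE-left⁺ : f ≢ eᵂ → FunctionalEEdge (root P) f → FunctionalEEdge (root G₀) f
    functionalE-left⁺ {f} f≢eᵂ ((f∈P , _ , no-out) , unique) =
      (f∈G , target∈ (root G₀) f∈G , no-out′) , unique′
      where
      f∈G : G₀ ∋ f
      f∈G = inj₁ (f∈P , f≢eᵂ)

      no-out′ : ∀ u → ¬ G₀ ∋ (proj₂ f , u)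
      no-out′ u (inj₁ (out , _))        = no-out u out
      no-out′ u (inj₂ (inj₁ (out , _))) = P#Q (target∈ᴸ P f∈P) (source∈ᴸ Q out)
      no-out′ u (inj₂ (inj₂ refl))      = no-out _ (cutW∋ p)

      unique′ : G₀ ∋ (x , proj₂ f) → x ≡ proj₁ f
      unique′ (inj₁ (into , _))        = unique into
      unique′ (inj₂ (inj₁ (into , _))) = ⊥-elim (P#Q (target∈ᴸ P f∈P) (target∈ᴸ Q into))
      unique′ (inj₂ (inj₂ refl))       = ⊥-elim (P#Q (target∈ᴸ P f∈P) (target∈ᴸ Q (cutE∋ p)))

    functionalE-right⁺ : f ≢ eᴱ → FunctionalEEdge (root Q) f → FunctionalEEdge (root G₀) f
    functionalE-right⁺ {f} f≢eᴱ ((f∈Q , _ , no-out) , unique) =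
      (f∈G , target∈ (root G₀) f∈G , no-out′) , unique′
      where
      f∈G : G₀ ∋ f
      f∈G = inj₂ (inj₁ (f∈Q , f≢eᴱ))

      no-out′ : ∀ u → ¬ G₀ ∋ (proj₂ f , u)
      no-out′ u (inj₁ (out , _))        = P#Q (source∈ᴸ P out) (target∈ᴸ Q f∈Q)
      no-out′ u (inj₂ (inj₁ (out , _))) = no-out u out
      no-out′ u (inj₂ (inj₂ refl))      = P#Q (source∈ᴸ P (cutW∋ p)) (target∈ᴸ Q f∈Q)

      unique′ : G₀ ∋ (x , proj₂ f) → x ≡ proj₁ f
      unique′ (inj₁ (into , _))        = ⊥-elim (P#Q (target∈ᴸ P into) (target∈ᴸ Q f∈Q))
      unique′ (inj₂ (inj₁ (into , _))) = unique into
      -- The new edge ends where `eᴱ` does; were this the target of `f`, functionality of `f` in `Q`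
      -- would give `f ≡ eᴱ`.
      unique′ (inj₂ (inj₂ refl))       = contradiction
        (cong (_, proj₂ f) (sym (unique (cutE∋ p)))) f≢eᴱ

    functionalW-right⁺ : f ≢ eᴱ → FunctionalWEdge (root Q) f → FunctionalWEdge (root G₀) f
    functionalW-right⁺ {f} f≢eᴱ ((f∈Q , _ , no-in) , unique) =
      (f∈G , source∈ (root G₀) f∈G , no-in′) , unique′
      where
      f∈G : G₀ ∋ f
      f∈G = inj₂ (inj₁ (f∈Q , f≢eᴱ))

      no-in′ : ∀ u → ¬ G₀ ∋ (u , proj₁ f)
      no-in′ u (inj₁ (into , _))        = P#Q (target∈ᴸ P into) (source∈ᴸ Q f∈Q)
      no-in′ u (inj₂ (inj₁ (into , _))) = no-in u into
      no-in′ u (inj₂ (inj₂ refl))       = no-in _ (cutE∋ p)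

      unique′ : G₀ ∋ (proj₁ f , y) → y ≡ proj₂ f
      unique′ (inj₁ (out , _))        = ⊥-elim (P#Q (source∈ᴸ P out) (source∈ᴸ Q f∈Q))
      unique′ (inj₂ (inj₁ (out , _))) = unique out
      unique′ (inj₂ (inj₂ refl))      = ⊥-elim (P#Q (source∈ᴸ P (cutW∋ p)) (source∈ᴸ Q f∈Q))

    functionalW-left⁺ : f ≢ eᵂ → FunctionalWEdge (root P) f → FunctionalWEdge (root G₀) f
    functionalW-left⁺ {f} f≢eᵂ ((f∈P , _ , no-in) , unique) =
      (f∈G , source∈ (root G₀) f∈G , no-in′) , unique′
      where
      f∈G : G₀ ∋ f
      f∈G = inj₁ (f∈P , f≢eᵂ)

      no-in′ : ∀ u → ¬ G₀ ∋ (u , proj₁ f)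
      no-in′ u (inj₁ (into , _))        = no-in u into
      no-in′ u (inj₂ (inj₁ (into , _))) = P#Q (source∈ᴸ P f∈P) (target∈ᴸ Q into)
      no-in′ u (inj₂ (inj₂ refl))       = P#Q (source∈ᴸ P f∈P) (target∈ᴸ Q (cutE∋ p))

      unique′ : G₀ ∋ (proj₁ f , y) → y ≡ proj₂ f
      unique′ (inj₁ (out , _))        = unique out
      unique′ (inj₂ (inj₁ (out , _))) = ⊥-elim (P#Q (source∈ᴸ P f∈P) (source∈ᴸ Q out))
      unique′ (inj₂ (inj₂ refl))      = contradiction
        (cong (proj₁ f ,_) (sym (unique (cutW∋ p)))) f≢eᵂ

    -- By contraposition: the cut turns no W- or E-vertex of `P` that remains into an inner one.
    -- Edges of `Q` do not meet `P`, and the new edge ends in `Q` and begins where `eᵂ` already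
    -- began.
    InnerVertex-left⁻ : v ∈ vertices (root P) → InnerVertex (root G₀) v → InnerVertex (root P) v
    InnerVertex-left⁻ {v} v∈P (v∈G , ¬W , ¬E) = v∈P , ¬W ∘ W⁺ , ¬E ∘ E⁺
      where
      v∈ᴸP : v ∈ᴸ P
      v∈ᴸP = root⇒∈ᴸ P v∈P

      W⁺ : WVertex (root P) v → WVertex (root G₀) v
      W⁺ (_ , no-in) = v∈G , λ where
        u (inj₁ (into , _))        → no-in u into
        u (inj₂ (inj₁ (into , _))) → P#Q v∈ᴸP (target∈ᴸ Q into)
        u (inj₂ (inj₂ refl))       → P#Q v∈ᴸP (target∈ᴸ Q (cutE∋ p))

      E⁺ : EVertex (root P) v → EVertex (root G₀) v
      E⁺ (_ , no-out) = v∈G , λ where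
        u (inj₁ (out , _))        → no-out u out
        u (inj₂ (inj₁ (out , _))) → P#Q v∈ᴸP (source∈ᴸ Q out)
        u (inj₂ (inj₂ refl))      → no-out _ (cutW∋ p)

    InnerVertex-right⁻ : v ∈ vertices (root Q) → InnerVertex (root G₀) v → InnerVertex (root Q) v
    InnerVertex-right⁻ {v} v∈Q (v∈G , ¬W , ¬E) = v∈Q , ¬W ∘ W⁺ , ¬E ∘ E⁺
      where
      v∈ᴸQ : v ∈ᴸ Q
      v∈ᴸQ = root⇒∈ᴸ Q v∈Q

      W⁺ : WVertex (root Q) v → WVertex (root G₀) v
      W⁺ (_ , no-in) = v∈G , λ where
        u (inj₁ (into , _))        → P#Q (target∈ᴸ P into) v∈ᴸQ
        u (inj₂ (inj₁ (into , _))) → no-in u into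
        u (inj₂ (inj₂ refl))       → no-in _ (cutE∋ p)

      E⁺ : EVertex (root Q) v → EVertex (root G₀) v
      E⁺ (_ , no-out) = v∈G , λ where
        u (inj₁ (out , _))        → P#Q (source∈ᴸ P out) v∈ᴸQ
        u (inj₂ (inj₁ (out , _))) → no-out u out
        u (inj₂ (inj₂ refl))      → P#Q (source∈ᴸ P (cutW∋ p)) v∈ᴸQ

  -- The permutations of two cuts

  module _ (p : Cuttable P eᵂ eᴱ Q) (q : Cuttable (P [ eᵂ - eᴱ ] Q by p) fᵂ fᴱ R)
           (r : Cuttable Q fᵂ fᴱ R) (s : Cuttable P eᵂ eᴱ (Q [ fᵂ - fᴱ ] R by r))
           (P#Q : P # Q) (P#R : P # R) (Q#R : Q # R) where

    private
      G₁ = (P [ eᵂ - eᴱ ] Q by p) [ fᵂ - fᴱ ] R by q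
      G₂ = P [ eᵂ - eᴱ ] (Q [ fᵂ - fᴱ ] R by r) by s

    ρ₁-≈ : G₁ ≈ρ G₂
    ρ₁-≈ = ≈-ρ₁ (ρ₁-step p q r s (proj₁ (functionalW p)) (proj₁ (functionalW r))
                                 (proj₁ (functionalE p)) (proj₁ (functionalE r)))

    -- Both graphs consist of the edges of the three parts without the four cut edges, together with
    -- the two new edges. What has to be checked is that an edge removed by the later cut is neither
    -- an edge of a foreign part nor the earlier new edge.
    ρ₁-∼ : G₁ ∼ G₂
    ρ₁-∼ = record
      { edge⁺ = λ where
          (inj₁ (inj₁ g , _))                   → inj₁ g
          (inj₁ (inj₂ (inj₁ (g , ≢eᴱ)) , ≢fᵂ)) → inj₂ (inj₁ (inj₁ (g , ≢fᵂ) , ≢eᴱ))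
          (inj₁ (inj₂ (inj₂ eq) , _))           → inj₂ (inj₂ eq)
          (inj₂ (inj₁ (g , ≢fᴱ)))               →
            inj₂ (inj₁ (inj₂ (inj₁ (g , ≢fᴱ)) , #⇒≢ R Q (flip′ Q#R) g (cutE∋ p)))
          (inj₂ (inj₂ refl))                    →
            inj₂ (inj₁ (inj₂ (inj₂ refl) ,
              -- Targets are compared because the sources of `eᴱ` and of the new edge both lie in
              -- `Q`.
              target-≢ R Q (flip′ Q#R) (target∈ᴸ R (cutE∋ r)) (target∈ᴸ Q (cutE∋ p))))
      ; edge⁻ = λ where
          (inj₁ (g , ≢eᵂ))                      →
            inj₁ (inj₁ (g , ≢eᵂ) , #⇒≢ P Q P#Q g (cutW∋ r))
          (inj₂ (inj₁ (inj₁ (g , ≢fᵂ) , ≢eᴱ))) → inj₁ (inj₂ (inj₁ (g , ≢eᴱ)) , ≢fᵂ)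
          (inj₂ (inj₁ (inj₂ (inj₁ g) , _)))     → inj₂ (inj₁ g)
          (inj₂ (inj₁ (inj₂ (inj₂ eq) , _)))    → inj₂ (inj₂ eq)
          (inj₂ (inj₂ refl))                    →
            inj₁ (inj₂ (inj₂ refl) ,
              -- Here the targets both lie in `Q`, so the sources are compared.
              source-≢ P Q P#Q (source∈ᴸ P (cutW∋ p)) (source∈ᴸ Q (cutW∋ r)))
      ; dist≡ = dists
      ; leaf⁺ = [ [ ∈ᴸ-left {p = s} , ∈ᴸ-right {p = s} ∘′ ∈ᴸ-left {p = r} ]′ ∘′ ∈ᴸ-cut⁻ {p = p}
                , ∈ᴸ-right {p = s} ∘′ ∈ᴸ-right {p = r} ]′ ∘′ ∈ᴸ-cut⁻ {p = q}
      ; leaf⁻ = [ ∈ᴸ-left {p = q} ∘′ ∈ᴸ-left {p = p}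
                , [ ∈ᴸ-left {p = q} ∘′ ∈ᴸ-right {p = p} , ∈ᴸ-right {p = q} ]′
                    ∘′ ∈ᴸ-cut⁻ {p = r} ]′ ∘′ ∈ᴸ-cut⁻ {p = s}
      }
      where
      dists : ∀ Y X → dist Y X G₁ ≡ dist Y X G₂
      dists Y W rewrite dist-W Y q | dist-W Y p | dist-W Y s | dist-W Y r =
        sym (replace-assoc (#⇒≢dist Y W Q R Q#R (cutE∋ p)))
      dists Y E rewrite dist-E Y q | dist-E Y p | dist-E Y s | dist-E Y r =
        replace-assoc (#⇒≢dist Y E Q P (flip′ P#Q) (cutW∋ r))

  -- Definedness of the permuted cuts

  module _ (p : Cuttable P eᵂ eᴱ Q) (q : Cuttable (P [ eᵂ - eᴱ ] Q by p) fᵂ fᴱ R)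
           (P#Q : P # Q) (P#R : P # R) (Q#R : Q # R) where

    -- An edge of `Q` can be a distinguished E-edge of the composite only if that edge was inherited
    -- from `Q`.
    ρ₁-innerʳ : Q ∋ fᵂ → Cuttable Q fᵂ fᴱ R
    ρ₁-innerʳ fᵂ∈Q = record
      { disjoint      = #⇒Disjoint Q R Q#R
      ; functionalW   = functionalE-right⁻ p P#Q fᵂ∈Q (functionalW q)
      ; functionalE   = functionalE q
      ; distinguished = λ Y → Sum.map₁
          (λ eq → from-replacement (#⇒≢dist Y E Q P (flip′ P#Q) fᵂ∈Q) (trans eq (dist-E Y p)))
          (distinguished q Y)
      }

    ρ₁-outerʳ : fᵂ ≢ eᴱ → (r : Cuttable Q fᵂ fᴱ R) → Cuttable P eᵂ eᴱ (Q [ fᵂ - fᴱ ] R by r)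
    ρ₁-outerʳ fᵂ≢eᴱ r = record
      { disjoint      = #⇒Disjoint P (Q [ fᵂ - fᴱ ] R by r) (#-cutʳ {p = r} {R = P} P#Q P#R)
      ; functionalW   = functionalW p
      ; functionalE   = functionalW-left⁺ r Q#R (fᵂ≢eᴱ ∘ sym) (functionalE p)
      ; distinguished = λ Y → Sum.map₂ (λ eq → trans eq (sym (dist-W Y r)))
          (distinguished-assoc (#⇒≢dist Y E Q P (flip′ P#Q) (cutW∋ r)) (distinguished p Y)
            (Sum.map₁ (λ eq → trans eq (dist-E Y p)) (distinguished q Y)))
      }

    ρ₂-inner : fᵂ ≢ eᵂ → P ∋ fᵂ → Cuttable P fᵂ fᴱ R
    ρ₂-inner fᵂ≢eᵂ fᵂ∈P = record
      { disjoint      = #⇒Disjoint P R P#R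
      ; functionalW   = functionalE-left⁻ p P#Q fᵂ≢eᵂ fᵂ∈P (functionalW q)
      ; functionalE   = functionalE q
      ; distinguished = λ Y → Sum.map₁
          (λ eq → from-original (#⇒≢dist Y E P Q P#Q fᵂ∈P) (trans eq (dist-E Y p)))
          (distinguished q Y)
      }

    ρ₂-outer : fᵂ ≢ eᵂ → (r : Cuttable P fᵂ fᴱ R) → Cuttable (P [ fᵂ - fᴱ ] R by r) eᵂ eᴱ Q
    ρ₂-outer fᵂ≢eᵂ r = record
      { disjoint      =
          #⇒Disjoint (P [ fᵂ - fᴱ ] R by r) Q (#-cutˡ {p = r} {R = Q} P#Q (flip′ Q#R))
      ; functionalW   = functionalE-left⁺ r P#R (fᵂ≢eᵂ ∘ sym) (functionalW p)
      ; functionalE   = functionalE p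
      ; distinguished = λ Y → Sum.map₁
          -- If `eᵂ` is distinguished in `P`, then `fᵂ`, being different, is not, so the cut at `fᵂ`
          -- leaves `eᵂ` distinguished.
          (λ eq → trans eq (sym (trans (dist-E Y r)
                    (replace-miss (λ fᵂ≡ → fᵂ≢eᵂ (trans fᵂ≡ (sym eq)))))))
          (distinguished p Y)
      }

  module _ (r : Cuttable Q fᵂ fᴱ R) (s : Cuttable P eᵂ eᴱ (Q [ fᵂ - fᴱ ] R by r))
           (P#Q : P # Q) (P#R : P # R) (Q#R : Q # R) where

    ρ₁-innerˡ : Q ∋ eᴱ → Cuttable P eᵂ eᴱ Q
    ρ₁-innerˡ eᴱ∈Q = record
      { disjoint      = #⇒Disjoint P Q P#Q
      ; functionalW   = functionalW s
      ; functionalE   = functionalW-left⁻ r Q#R eᴱ∈Q (functionalE s)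
      ; distinguished = λ Y → Sum.map₂
          (λ eq → from-replacement (#⇒≢dist Y W Q R Q#R eᴱ∈Q) (trans eq (dist-W Y r)))
          (distinguished s Y)
      }

    ρ₁-outerˡ : eᴱ ≢ fᵂ → (p : Cuttable P eᵂ eᴱ Q) → Cuttable (P [ eᵂ - eᴱ ] Q by p) fᵂ fᴱ R
    ρ₁-outerˡ eᴱ≢fᵂ p = record
      { disjoint      = #⇒Disjoint (P [ eᵂ - eᴱ ] Q by p) R (#-cutˡ {p = p} {R = R} P#R Q#R)
      ; functionalW   = functionalE-right⁺ p P#Q (eᴱ≢fᵂ ∘ sym) (functionalW r)
      ; functionalE   = functionalE r
      -- The mirror image of the opposite reassociation: swapping the alternatives exchanges `P`
      -- with `R` and W with E.
      ; distinguished = λ Y → Sum.map₁ (λ eq → trans eq (sym (dist-E Y p))) (Sum.swap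
          (distinguished-assoc (#⇒≢dist Y W Q R Q#R (cutE∋ p)) (Sum.swap (distinguished r Y))
            (Sum.map₁ (λ eq → trans eq (dist-W Y r)) (Sum.swap (distinguished s Y)))))
      }

  module _ (p : Cuttable Q eᵂ eᴱ P) (q : Cuttable R fᵂ fᴱ (Q [ eᵂ - eᴱ ] P by p))
           (Q#P : Q # P) (R#P : R # P) (Q#R : Q # R) where

    ρ₃-inner : fᴱ ≢ eᴱ → P ∋ fᴱ → Cuttable R fᵂ fᴱ P
    ρ₃-inner fᴱ≢eᴱ fᴱ∈P = record
      { disjoint      = #⇒Disjoint R P R#P
      ; functionalW   = functionalW q
      ; functionalE   = functionalW-right⁻ p Q#P fᴱ≢eᴱ fᴱ∈P (functionalE q)
      ; distinguished = λ Y → Sum.map₂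
          (λ eq → from-original (#⇒≢dist Y W P Q (flip′ Q#P) fᴱ∈P) (trans eq (dist-W Y p)))
          (distinguished q Y)
      }

    ρ₃-outer : fᴱ ≢ eᴱ → (r : Cuttable R fᵂ fᴱ P) → Cuttable Q eᵂ eᴱ (R [ fᵂ - fᴱ ] P by r)
    ρ₃-outer fᴱ≢eᴱ r = record
      { disjoint      = #⇒Disjoint Q (R [ fᵂ - fᴱ ] P by r) (#-cutʳ {p = r} {R = Q} Q#R Q#P)
      ; functionalW   = functionalW p
      ; functionalE   = functionalW-right⁺ r R#P (fᴱ≢eᴱ ∘ sym) (functionalE p)
      ; distinguished = λ Y → Sum.map₂
          (λ eq → trans eq (sym (trans (dist-W Y r)
                    (replace-miss (λ fᴱ≡ → fᴱ≢eᴱ (trans fᴱ≡ (sym eq)))))))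
          (distinguished p Y)
      }

  -- Similarity under exchange of two cuts on the same side of one part

  module _ (p : Cuttable P eᵂ eᴱ Q) (q : Cuttable (P [ eᵂ - eᴱ ] Q by p) fᵂ fᴱ R)
           (r : Cuttable P fᵂ fᴱ R) (s : Cuttable (P [ fᵂ - fᴱ ] R by r) eᵂ eᴱ Q)
           where

    -- Only one inclusion is proved: exchanging `p`, `q` with `r`, `s` yields the other.
    ρ₂-edge : P # R →
              (P [ eᵂ - eᴱ ] Q by p) [ fᵂ - fᴱ ] R by q ∋ (x , y) →
              (P [ fᵂ - fᴱ ] R by r) [ eᵂ - eᴱ ] Q by s ∋ (x , y)
    ρ₂-edge P#R (inj₁ (inj₁ (g , ≢eᵂ) , ≢fᵂ)) = inj₁ (inj₁ (g , ≢fᵂ) , ≢eᵂ)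
    ρ₂-edge P#R (inj₁ (inj₂ g , _)) = inj₂ g
    ρ₂-edge P#R (inj₂ (inj₁ (g , ≢fᴱ))) =
      inj₁ (inj₂ (inj₁ (g , ≢fᴱ)) , #⇒≢ R P (flip′ P#R) g (cutW∋ p))
    ρ₂-edge P#R (inj₂ (inj₂ refl)) =
      inj₁ (inj₂ (inj₂ refl) ,
        target-≢ R P (flip′ P#R) (target∈ᴸ R (cutE∋ r)) (target∈ᴸ P (cutW∋ p)))

    ρ₂-leaf : v ∈ᴸ (P [ eᵂ - eᴱ ] Q by p) [ fᵂ - fᴱ ] R by q →
              v ∈ᴸ (P [ fᵂ - fᴱ ] R by r) [ eᵂ - eᴱ ] Q by s
    ρ₂-leaf = [ [ ∈ᴸ-left {p = s} ∘′ ∈ᴸ-left {p = r} , ∈ᴸ-right {p = s} ]′ ∘′ ∈ᴸ-cut⁻ {p = p}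
              , ∈ᴸ-left {p = s} ∘′ ∈ᴸ-right {p = r} ]′ ∘′ ∈ᴸ-cut⁻ {p = q}

  module _ (p : Cuttable P eᵂ eᴱ Q) (q : Cuttable (P [ eᵂ - eᴱ ] Q by p) fᵂ fᴱ R)
           (r : Cuttable P fᵂ fᴱ R) (s : Cuttable (P [ fᵂ - fᴱ ] R by r) eᵂ eᴱ Q)
           (fᵂ≢eᵂ : fᵂ ≢ eᵂ) (P#Q : P # Q) (P#R : P # R) where

    private
      G₁ = (P [ eᵂ - eᴱ ] Q by p) [ fᵂ - fᴱ ] R by q
      G₂ = (P [ fᵂ - fᴱ ] R by r) [ eᵂ - eᴱ ] Q by s

    ρ₂-≈ : G₁ ≈ρ G₂
    ρ₂-≈ = ≈-ρ₂ (ρ₂-step p q r s (fᵂ≢eᵂ ∘ sym) (proj₁ (functionalW p)) (proj₁ (functionalW r))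
                                               (proj₁ (functionalE p)) (proj₁ (functionalE r)))

    ρ₂-∼ : G₁ ∼ G₂
    ρ₂-∼ = record
      { edge⁺ = ρ₂-edge p q r s P#R
      ; edge⁻ = ρ₂-edge r s p q P#Q
      ; dist≡ = dists
      ; leaf⁺ = ρ₂-leaf p q r s
      ; leaf⁻ = ρ₂-leaf r s p q
      }
      where
      -- The different edges `eᵂ` and `fᵂ` cannot both be the distinguished E-edge of `P` at the
      -- pole `Y`, so one of the cuts meets its condition on the W side.
      one-side : ∀ Y → fᴱ ≡ dist Y W R ⊎ eᴱ ≡ dist Y W Q
      one-side Y with distinguished r Y | distinguished p Y
      ... | inj₂ fᴱ≡ | _        = inj₁ fᴱ≡
      ... | inj₁ _   | inj₂ eᴱ≡ = inj₂ eᴱ≡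
      ... | inj₁ fᵂ≡ | inj₁ eᵂ≡ = contradiction (trans fᵂ≡ (sym eᵂ≡)) fᵂ≢eᵂ

      dists : ∀ Y X → dist Y X G₁ ≡ dist Y X G₂
      dists Y W rewrite dist-W Y q | dist-W Y p | dist-W Y s | dist-W Y r =
        replace-swap-outer (one-side Y)
      dists Y E rewrite dist-E Y q | dist-E Y p | dist-E Y s | dist-E Y r =
        replace-swap-inner (fᵂ≢eᵂ ∘ sym) (#⇒≢dist Y E P Q P#Q (cutW∋ r))
                                         (#⇒≢dist Y E P R P#R (cutW∋ p))

  module _ (p : Cuttable Q eᵂ eᴱ P) (q : Cuttable R fᵂ fᴱ (Q [ eᵂ - eᴱ ] P by p))
           (r : Cuttable R fᵂ fᴱ P) (s : Cuttable Q eᵂ eᴱ (R [ fᵂ - fᴱ ] P by r))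
           where

    ρ₃-edge : R # P →
              R [ fᵂ - fᴱ ] (Q [ eᵂ - eᴱ ] P by p) by q ∋ (x , y) →
              Q [ eᵂ - eᴱ ] (R [ fᵂ - fᴱ ] P by r) by s ∋ (x , y)
    ρ₃-edge R#P (inj₁ (g , ≢fᵂ)) =
      inj₂ (inj₁ (inj₁ (g , ≢fᵂ) , #⇒≢ R P R#P g (cutE∋ p)))
    ρ₃-edge R#P (inj₂ (inj₁ (inj₁ g , _))) = inj₁ g
    ρ₃-edge R#P (inj₂ (inj₁ (inj₂ (inj₁ (g , ≢eᴱ)) , ≢fᴱ))) =
      inj₂ (inj₁ (inj₂ (inj₁ (g , ≢fᴱ)) , ≢eᴱ))
    ρ₃-edge R#P (inj₂ (inj₁ (inj₂ (inj₂ eq) , _))) = inj₂ (inj₂ eq)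
    ρ₃-edge R#P (inj₂ (inj₂ refl)) =
      inj₂ (inj₁ (inj₂ (inj₂ refl) ,
        source-≢ R P R#P (source∈ᴸ R (cutW∋ r)) (source∈ᴸ P (cutE∋ p))))

    ρ₃-leaf : v ∈ᴸ R [ fᵂ - fᴱ ] (Q [ eᵂ - eᴱ ] P by p) by q →
              v ∈ᴸ Q [ eᵂ - eᴱ ] (R [ fᵂ - fᴱ ] P by r) by s
    ρ₃-leaf = [ ∈ᴸ-right {p = s} ∘′ ∈ᴸ-left {p = r}
              , [ ∈ᴸ-left {p = s} , ∈ᴸ-right {p = s} ∘′ ∈ᴸ-right {p = r} ]′
                  ∘′ ∈ᴸ-cut⁻ {p = p} ]′ ∘′ ∈ᴸ-cut⁻ {p = q}

  module _ (p : Cuttable Q eᵂ eᴱ P) (q : Cuttable R fᵂ fᴱ (Q [ eᵂ - eᴱ ] P by p))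
           (r : Cuttable R fᵂ fᴱ P) (s : Cuttable Q eᵂ eᴱ (R [ fᵂ - fᴱ ] P by r))
           (fᴱ≢eᴱ : fᴱ ≢ eᴱ) (Q#P : Q # P) (R#P : R # P) where

    private
      G₁ = R [ fᵂ - fᴱ ] (Q [ eᵂ - eᴱ ] P by p) by q
      G₂ = Q [ eᵂ - eᴱ ] (R [ fᵂ - fᴱ ] P by r) by s

    ρ₃-≈ : G₁ ≈ρ G₂
    ρ₃-≈ = ≈-ρ₃ (ρ₃-step p q r s (fᴱ≢eᴱ ∘ sym) (proj₁ (functionalE p)) (proj₁ (functionalE r))
                                               (proj₁ (functionalW p)) (proj₁ (functionalW r)))

    ρ₃-∼ : G₁ ∼ G₂
    ρ₃-∼ = record
      { edge⁺ = ρ₃-edge p q r s R#P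
      ; edge⁻ = ρ₃-edge r s p q Q#P
      ; dist≡ = dists
      ; leaf⁺ = ρ₃-leaf p q r s
      ; leaf⁻ = ρ₃-leaf r s p q
      }
      where
      one-side : ∀ Y → fᵂ ≡ dist Y E R ⊎ eᵂ ≡ dist Y E Q
      one-side Y with distinguished r Y | distinguished p Y
      ... | inj₁ fᵂ≡ | _        = inj₁ fᵂ≡
      ... | inj₂ _   | inj₁ eᵂ≡ = inj₂ eᵂ≡
      ... | inj₂ fᴱ≡ | inj₂ eᴱ≡ = contradiction (trans fᴱ≡ (sym eᴱ≡)) fᴱ≢eᴱ

      dists : ∀ Y X → dist Y X G₁ ≡ dist Y X G₂
      dists Y W rewrite dist-W Y q | dist-W Y p | dist-W Y s | dist-W Y r =
        replace-swap-inner (fᴱ≢eᴱ ∘ sym) (#⇒≢dist Y W P Q (flip′ Q#P) (cutE∋ r))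
                                         (#⇒≢dist Y W P R (flip′ R#P) (cutE∋ p))
      dists Y E rewrite dist-E Y q | dist-E Y p | dist-E Y s | dist-E Y r =
        replace-swap-outer (one-side Y)

  -- Splitting a construction at an inner edge

  -- The last two fields are what the induction needs in order to apply a
  -- further cut to the split construction and then to move it inside.
  record Split (G : Construction) (e : Edge) : Set where
    field
      {Hᵂ Hᴱ}    : Construction
      {cᵂ cᴱ}    : Edge
      cuttable   : Cuttable Hᵂ cᵂ cᴱ Hᴱ
      new        : newEdge cᵂ cᴱ ≡ e
      equivalent : G ≈ρ Hᵂ [ cᵂ - cᴱ ] Hᴱ by cuttable
      similar    : G ∼ Hᵂ [ cᵂ - cᴱ ] Hᴱ by cuttable
      apart      : Hᵂ # Hᴱ

  Split-resp : ∀ {G H} → G ≈ρ H → G ∼ H → Split H e → Split G e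
  Split-resp G≈H G∼H split = record
    { cuttable   = cuttable
    ; new        = new
    ; equivalent = ≈-trans G≈H equivalent
    ; similar    = ∼-trans G∼H similar
    ; apart      = apart
    } where open Split split

  -- If `fᵂ` comes from `P`, both cuts take E-edges of `P` and ρ₂ applies; if it comes from `Q`, the
  -- parts are in a row and ρ₁ applies.
  absorb-E : (p : Cuttable P eᵂ eᴱ Q) (q : Cuttable (P [ eᵂ - eᴱ ] Q by p) fᵂ fᴱ R) →
             P # Q → P # R → Q # R → newEdge eᵂ eᴱ ≢ fᵂ →
             Split ((P [ eᵂ - eᴱ ] Q by p) [ fᵂ - fᴱ ] R by q) (newEdge eᵂ eᴱ)
  absorb-E {P} {Q = Q} p q P#Q P#R Q#R e≢fᵂ with cutW∋ q
  ... | inj₁ (fᵂ∈P , fᵂ≢eᵂ) = record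
    { cuttable   = s
    ; new        = refl
    ; equivalent = ρ₂-≈ p q r s fᵂ≢eᵂ P#Q P#R
    ; similar    = ρ₂-∼ p q r s fᵂ≢eᵂ P#Q P#R
    ; apart      = #-cutˡ {p = r} {R = Q} P#Q (flip′ Q#R)
    }
    where
    r = ρ₂-inner p q P#Q P#R Q#R fᵂ≢eᵂ fᵂ∈P
    s = ρ₂-outer p q P#Q P#R Q#R fᵂ≢eᵂ r
  ... | inj₂ (inj₁ (fᵂ∈Q , fᵂ≢eᴱ)) = record
    { cuttable   = s
    ; new        = refl
    ; equivalent = ρ₁-≈ p q r s P#Q P#R Q#R
    ; similar    = ρ₁-∼ p q r s P#Q P#R Q#R
    ; apart      = #-cutʳ {p = r} {R = P} P#Q P#R
    }
    where
    r = ρ₁-innerʳ p q P#Q P#R Q#R fᵂ∈Q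
    s = ρ₁-outerʳ p q P#Q P#R Q#R fᵂ≢eᴱ r
  ... | inj₂ (inj₂ fᵂ≡e) = contradiction (sym fᵂ≡e) e≢fᵂ

  absorb-W : (p : Cuttable P eᵂ eᴱ Q) (q : Cuttable R fᵂ fᴱ (P [ eᵂ - eᴱ ] Q by p)) →
             P # Q → R # P → R # Q → newEdge eᵂ eᴱ ≢ fᴱ →
             Split (R [ fᵂ - fᴱ ] (P [ eᵂ - eᴱ ] Q by p) by q) (newEdge eᵂ eᴱ)
  absorb-W {P} {Q = Q} p q P#Q R#P R#Q e≢fᴱ with cutE∋ q
  ... | inj₁ (fᴱ∈P , fᴱ≢eᵂ) = record
    { cuttable   = s
    ; new        = refl
    -- ρ₁ is used from right to left, for `R`, `P`, `Q` in a row.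
    ; equivalent = ≈-sym (ρ₁-≈ r s p q R#P R#Q P#Q)
    ; similar    = ∼-sym (ρ₁-∼ r s p q R#P R#Q P#Q)
    ; apart      = #-cutˡ {p = r} {R = Q} R#Q P#Q
    }
    where
    r = ρ₁-innerˡ p q R#P R#Q P#Q fᴱ∈P
    s = ρ₁-outerˡ p q R#P R#Q P#Q fᴱ≢eᵂ r
  ... | inj₂ (inj₁ (fᴱ∈Q , fᴱ≢eᴱ)) = record
    { cuttable   = s
    ; new        = refl
    ; equivalent = ρ₃-≈ p q r s fᴱ≢eᴱ P#Q R#Q
    ; similar    = ρ₃-∼ p q r s fᴱ≢eᴱ P#Q R#Q
    ; apart      = #-cutʳ {p = r} {R = P} (flip′ R#P) P#Q
    }
    where
    r = ρ₃-inner p q P#Q R#Q (flip′ R#P) fᴱ≢eᴱ fᴱ∈Q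
    s = ρ₃-outer p q P#Q R#Q (flip′ R#P) fᴱ≢eᴱ r
  ... | inj₂ (inj₂ fᴱ≡e) = contradiction (sym fᴱ≡e) e≢fᴱ

  -- Similarity of `P` and its split form makes the cut with `R` defined on the latter; congruence
  -- then replaces `P`, and the cut is moved inside.
  Split-cutE : (q : Cuttable P fᵂ fᴱ R) → P # R → e ≢ fᵂ → Split P e →
               Split (P [ fᵂ - fᴱ ] R by q) e
  Split-cutE {P} {R = R} q P#R e≢fᵂ record
    { Hᵂ = Hᵂ ; Hᴱ = Hᴱ ; cuttable = p ; new = refl ; equivalent = P≈H ; similar = P∼H
    ; apart = apart } =
    Split-resp (≈-cong P≈H ≈-refl q q′) (∼-cut P∼H ∼-refl q q′)
      (absorb-E p q′ apart (λ v∈Hᵂ → H#R (∈ᴸ-left {p = p} v∈Hᵂ))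
                           (λ v∈Hᴱ → H#R (∈ᴸ-right {p = p} v∈Hᴱ)) e≢fᵂ)
    where
    q′ = cuttable-resp P∼H ∼-refl P#R q

    H#R : Hᵂ [ _ - _ ] Hᴱ by p # R
    H#R v∈H = P#R (leaf⁻ P∼H v∈H)

  Split-cutW : (q : Cuttable R fᵂ fᴱ P) → R # P → e ≢ fᴱ → Split P e →
               Split (R [ fᵂ - fᴱ ] P by q) e
  Split-cutW {R} {P = P} q R#P e≢fᴱ record
    { Hᵂ = Hᵂ ; Hᴱ = Hᴱ ; cuttable = p ; new = refl ; equivalent = P≈H ; similar = P∼H
    ; apart = apart } =
    Split-resp (≈-cong ≈-refl P≈H q q′) (∼-cut ∼-refl P∼H q q′)
      (absorb-W p q′ apart (λ v∈R v∈Hᵂ → H#R (∈ᴸ-left {p = p} v∈Hᵂ) v∈R)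
                           (λ v∈R v∈Hᴱ → H#R (∈ᴸ-right {p = p} v∈Hᴱ) v∈R) e≢fᴱ)
    where
    q′ = cuttable-resp ∼-refl P∼H R#P q

    H#R : Hᵂ [ _ - _ ] Hᴱ by p # R
    H#R v∈H v∈R = R#P v∈R (leaf⁻ P∼H v∈H)

  -- For an edge ending in `b`, a further edge into its source would make it a loop or be its
  -- reverse, so the source is a W-vertex. Dually, the target of an edge beginning in `b` is an
  -- E-vertex.
  basic-no-inner : ∀ B → ¬ InnerEdge (BasicKGraph.graph B) e
  basic-no-inner B (xy@(inj₁ (_ , refl)) , (x∈ , ¬W , _) , _) = ¬W (x∈ , λ where
      u (inj₁ (_ , refl))      → irrefl refl xy
      u ux@(inj₂ (refl , _)) → irrefl (antisym ux xy) ux)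
    where open OrientedGraph (BasicKGraph.graph B) using (irrefl; antisym)
  basic-no-inner B (xy@(inj₂ (refl , _)) , _ , (y∈ , _ , ¬E)) = ¬E (y∈ , λ where
      u yu@(inj₁ (_ , refl)) → irrefl (antisym yu xy) yu
      u (inj₂ (refl , _))    → irrefl refl xy)
    where open OrientedGraph (BasicKGraph.graph B) using (irrefl; antisym)

  -- Innerness passes down to the part containing `e`, and leaves have no inner edges, so the
  -- descent stops at the cut that introduces `e`.
  split-at-inner : ∀ G → LeavesDisjoint G → InnerEdge (root G) e → Split G e
  split-at-inner (basic B) _ inner = contradiction inner (basic-no-inner B)
  split-at-inner (P [ _ - _ ] Q by p) ld (e∈ , x-inner , y-inner)
    with ldP , ldQ , P#Q ← LeavesDisjoint-cut⁻ {p = p} ld | e∈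
  ... | inj₁ (e∈P , e≢eᵂ) = Split-cutE p P#Q e≢eᵂ (split-at-inner P ldP
          ( e∈P
          , InnerVertex-left⁻ p P#Q (source∈ (root P) e∈P) x-inner
          , InnerVertex-left⁻ p P#Q (target∈ (root P) e∈P) y-inner ))
  ... | inj₂ (inj₁ (e∈Q , e≢eᴱ)) = Split-cutW p P#Q e≢eᴱ (split-at-inner Q ldQ
          ( e∈Q
          , InnerVertex-right⁻ p P#Q (source∈ (root Q) e∈Q) x-inner
          , InnerVertex-right⁻ p P#Q (target∈ (root Q) e∈Q) y-inner ))
  ... | inj₂ (inj₂ refl) = record
          { cuttable = p ; new = refl ; equivalent = ≈-refl ; similar = ∼-refl ; apart = P#Q }

proposition2p4 : {V : Set} (_≟_ : DecidableEquality V) →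
    let open Constructions _≟_ in
    (G : Construction) → LeavesDisjoint G →
    (e : Edge) → OrientedGraph.InnerEdge (root G) e →
    ∃[ Hᵂ ] ∃[ eᵂ ] ∃[ eᴱ ] ∃[ Hᴱ ] ∃[ p ]
    (G ≈ρ Hᵂ [ eᵂ - eᴱ ] Hᴱ by p) × newEdge eᵂ eᴱ ≡ e
proposition2p4 = λ _≟_ G ld e inner →
  let open Split (split-at-inner _≟_ G ld inner)
  in Hᵂ , cᵂ , cᴱ , Hᴱ , cuttable , equivalent , new
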